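{- Let $C_{(>,\leq)}(x,y)$ be the bivariate generating function of the Catalan words avoiding the ordered pair of relations $(>,\leq)$, where $x$ marks the length and $y$ marks the number of descents. Then $$C_{(>,\leq)}(x,y)=\frac{1 - x - x^2 y}{1 - 2 x - x^2 y}.$$
   Context: A Catalan word of length $n$ is a word $w=w_1w_2\cdots w_n$ over the non-negative integers with $w_1=0$ and $0\leq w_i\leq w_{i-1}+1$ for $i=2,\dots,n$; the empty word is the unique Catalan word of length $0$. For relations $X,Y\in\{<,>,\leq,\geq,=,\neq\}$, a word $w$ contains the pattern $(X,Y)$ if there is an index $i\geq 1$ (with $i+2\le n$) such that $w_i\,X\,w_{i+1}$ and $w_{i+1}\,Y\,w_{i+2}$; otherwise $w$ avoids $(X,Y)$. The number of descents $\mathrm{des}(w)$ is the number of indices $i$ with $w_i>w_{i+1}$. The bivariate generating function is $C_{(X,Y)}(x,y)=\sum_{w}x^{|w|}y^{\mathrm{des}(w)}$, the sum being over all Catalan words $w$ (of any length $|w|\geq 0$) avoiding $(X,Y)$. Identities are between formal power series in $x$ with coefficients polynomials in $y$. -}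

module Defs where

open import Data.Bool.Base using (if_then_else_)
open import Data.Integer.Base as ℤ using (ℤ; 0ℤ; 1ℤ)
open import Data.List.Base using (List; []; _∷_; _++_; map; foldr; filter; concat; replicate; length; upTo; applyUpTo)
open import Data.List.Membership.Propositional using (_∈_)
open import Data.List.Membership.Propositional.Properties using (∈-map⁺; ∈-map⁻; ∈-concat⁺′; ∈-concat⁻′; ∈-upTo⁺; ∈-upTo⁻)
open import Data.List.Properties using (∷-injectiveˡ; ∷-injectiveʳ)
open import Data.List.Relation.Unary.All as All using ([])
import Data.List.Relation.Unary.All.Properties as All
open import Data.List.Relation.Unary.AllPairs as AllPairs using ([]; _∷_)
import Data.List.Relation.Unary.AllPairs.Properties as AllPairs
open import Data.List.Relation.Unary.Any using (here)
open import Data.List.Relation.Unary.Linked using (Linked; []; [-]; _∷_)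
open import Data.List.Relation.Unary.Unique.Propositional using (Unique)
import Data.List.Relation.Unary.Unique.Propositional.Properties as Unique
open import Data.Nat.Base using (ℕ; zero; suc; _+_; _∸_; _≤_; z≤n; s≤s; _≡ᵇ_)
open import Data.Nat.Properties using (_>?_)
open import Data.Product.Base using (_×_; _,_; ∃-syntax)
open import Data.Unit.Base using (⊤; tt)
open import Function.Base using (_∘_)
open import Function.Bundles using (_⇔_; mk⇔)
open import Level using (0ℓ)
open import Relation.Binary.Core using (Rel)
open import Relation.Binary.Definitions using (Decidable)
open import Relation.Binary.PropositionalEquality.Core using (_≡_; refl; sym; trans; _≢_)
open import Relation.Nullary.Decidable using (Dec; yes; no; does; map′; _×-dec_; _⊎-dec_; ¬?)
open import Relation.Nullary.Negation using (¬_)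
open import Data.Sum.Base using (_⊎_; inj₁; inj₂)

Word : Set
Word = List ℕ

CatalanWord : Word → Set
CatalanWord []      = ⊤
CatalanWord (a ∷ w) = a ≡ 0 × Linked (λ b c → c ≤ b + 1) (a ∷ w)

data Contains (X Y : Rel ℕ 0ℓ) : Word → Set where
  here  : ∀ {a b c w} → X a b → Y b c → Contains X Y (a ∷ b ∷ c ∷ w)
  there : ∀ {a w} → Contains X Y w → Contains X Y (a ∷ w)

Avoids : (X Y : Rel ℕ 0ℓ) → Word → Set
Avoids X Y w = ¬ Contains X Y w

module _ {X Y : Rel ℕ 0ℓ} (X? : Decidable X) (Y? : Decidable Y) where

  contains? : (w : Word) → Dec (Contains X Y w)
  contains? []                = no λ ()
  contains? (a ∷ [])          = no λ { (there ()) }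
  contains? (a ∷ b ∷ [])      = no λ { (there (there ())) }
  contains? (a ∷ b ∷ c ∷ w)   =
    map′ (λ { (inj₁ (p , q)) → here p q ; (inj₂ r) → there r })
         (λ { (here p q) → inj₁ (p , q) ; (there r) → inj₂ r })
         ((X? a b ×-dec Y? b c) ⊎-dec contains? (b ∷ c ∷ w))

  avoids? : (w : Word) → Dec (Avoids X Y w)
  avoids? w = ¬? (contains? w)

des : Word → ℕ
des []          = 0
des (_ ∷ [])    = 0
des (a ∷ b ∷ w) = (if does (a >? b) then 1 else 0) + des (b ∷ w)

-- The words of length n with first letter at most k in which each letter
-- exceeds the previous one by at most 1.
wordsFrom : (k n : ℕ) → List Word
wordsFrom k zero    = [] ∷ []
wordsFrom k (suc n) = concat (map (λ a → map (a ∷_) (wordsFrom (a + 1) n)) (upTo (suc k)))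

catalanWords : (n : ℕ) → List Word
catalanWords n = wordsFrom 0 n

private

  From : ℕ → Word → Set
  From k []      = ⊤
  From k (a ∷ w) = a ≤ k × Linked (λ b c → c ≤ b + 1) (a ∷ w)

  From-∷⁺ : ∀ {a k} w → a ≤ k → From (a + 1) w → From k (a ∷ w)
  From-∷⁺ []      p _       = p , [-]
  From-∷⁺ (_ ∷ _) p (q , l) = p , q ∷ l

  From-∷⁻ : ∀ {a k} w → From k (a ∷ w) → From (a + 1) w
  From-∷⁻ []      _           = tt
  From-∷⁻ (_ ∷ _) (_ , q ∷ l) = q , l

  s≤s⁻ : ∀ {m n} → suc m ≤ suc n → m ≤ n
  s≤s⁻ (s≤s p) = p

  sound : ∀ k n w → w ∈ wordsFrom k n → From k w × length w ≡ n
  sound k zero    w (here refl) = tt , refl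
  sound k (suc n) w w∈ with ∈-concat⁻′ (map (λ a → map (a ∷_) (wordsFrom (a + 1) n)) (upTo (suc k))) w∈
  ... | _ , w∈ws , ws∈ with ∈-map⁻ _ ws∈
  ... | a , a∈ , refl with ∈-map⁻ _ w∈ws
  ... | v , v∈ , refl with sound (a + 1) n v v∈
  ... | f , refl = From-∷⁺ v (s≤s⁻ (∈-upTo⁻ a∈)) f , refl

  complete : ∀ k n w → From k w → length w ≡ n → w ∈ wordsFrom k n
  complete k zero    []      _         _    = here refl
  complete k (suc n) (a ∷ w) f@(p , _) refl =
    ∈-concat⁺′ (∈-map⁺ (a ∷_) (complete (a + 1) n w (From-∷⁻ w f) refl))
               (∈-map⁺ (λ b → map (b ∷_) (wordsFrom (b + 1) n)) (∈-upTo⁺ (s≤s p)))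

  unique : ∀ k n → Unique (wordsFrom k n)
  unique k zero    = [] ∷ []
  unique k (suc n) = Unique.concat⁺
    (All.map⁺ (All.universal (λ a → Unique.map⁺ ∷-injectiveʳ (unique (a + 1) n)) (upTo (suc k))))
    (AllPairs.map⁺ (AllPairs.map disjoint (Unique.upTo⁺ (suc k))))
    where
    disjoint : ∀ {a b} → a ≢ b → ∀ {w} →
      ¬ (w ∈ map (a ∷_) (wordsFrom (a + 1) n) × w ∈ map (b ∷_) (wordsFrom (b + 1) n))
    disjoint a≢b (w∈ , w∈′) with ∈-map⁻ _ w∈ | ∈-map⁻ _ w∈′
    ... | _ , _ , p | _ , _ , q = a≢b (∷-injectiveˡ (trans (sym p) q))

  From0⇒Catalan : ∀ w → From 0 w → CatalanWord w
  From0⇒Catalan []      _         = tt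
  From0⇒Catalan (_ ∷ _) (z≤n , l) = refl , l

  Catalan⇒From0 : ∀ w → CatalanWord w → From 0 w
  Catalan⇒From0 []      _          = tt
  Catalan⇒From0 (_ ∷ _) (refl , l) = z≤n , l

∈-catalanWords : ∀ n w → w ∈ catalanWords n ⇔ (CatalanWord w × length w ≡ n)
∈-catalanWords n w = mk⇔
  (λ w∈ → let f , e = sound 0 n w w∈ in From0⇒Catalan w f , e)
  (λ (c , e) → complete 0 n w (Catalan⇒From0 w c) e)

catalanWords-unique : ∀ n → Unique (catalanWords n)
catalanWords-unique n = unique 0 n

-- ℤ[y]: coefficient lists, constant term first. Trailing zeros are
-- allowed, so equality is equality of all coefficients.
Poly : Set
Poly = List ℤ

coeff : Poly → ℕ → ℤ
coeff []      _       = 0ℤ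
coeff (a ∷ p) zero    = a
coeff (a ∷ p) (suc k) = coeff p k

infix  4 _≈ᴾ_
infixl 6 _+ᴾ_
infixl 7 _*ᴾ_
infix  8 -ᴾ_ y^_

_≈ᴾ_ : Rel Poly 0ℓ
p ≈ᴾ q = ∀ k → coeff p k ≡ coeff q k

0ᴾ 1ᴾ y : Poly
0ᴾ = []
1ᴾ = 1ℤ ∷ []
y  = 0ℤ ∷ 1ℤ ∷ []

-ᴾ_ : Poly → Poly
-ᴾ_ = map (λ a → ℤ.- a)

_+ᴾ_ : Poly → Poly → Poly
[]      +ᴾ q       = q
(a ∷ p) +ᴾ []      = a ∷ p
(a ∷ p) +ᴾ (b ∷ q) = (a ℤ.+ b) ∷ (p +ᴾ q)

_*ᴾ_ : Poly → Poly → Poly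
[]      *ᴾ q = []
(a ∷ p) *ᴾ q = map (a ℤ.*_) q +ᴾ (0ℤ ∷ (p *ᴾ q))

y^_ : ℕ → Poly
y^ d = replicate d 0ℤ ++ 1ᴾ

sumᴾ : List Poly → Poly
sumᴾ = foldr _+ᴾ_ 0ᴾ

-- ℤ[y][[x]]: the value at n is the coefficient of xⁿ.
Series : Set
Series = ℕ → Poly

infix  4 _≈_ _≈_÷_
infixl 6 _-_
infixl 7 _*_
infix  8 _·x^_

_≈_ : Rel Series 0ℓ
f ≈ g = ∀ n → f n ≈ᴾ g n

_·x^_ : Poly → ℕ → Series
(p ·x^ m) n = if m ≡ᵇ n then p else 0ᴾ

1ˢ : Series
1ˢ = 1ᴾ ·x^ 0

_-_ : Series → Series → Series
(f - g) n = f n +ᴾ (-ᴾ g n)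

_*_ : Series → Series → Series
(f * g) n = sumᴾ (applyUpTo (λ i → f i *ᴾ g (n ∸ i)) (suc n))

-- f = g / h in ℤ[y][[x]]: the denominator h is invertible and f = g h⁻¹.
_≈_÷_ : Series → Series → Series → Set
f ≈ g ÷ h = ∃[ h⁻¹ ] (h * h⁻¹ ≈ 1ˢ) × (f ≈ g * h⁻¹)

-- The coefficient of xⁿ in C₍X,Y₎(x,y) is the sum of y^des(w) over the
-- Catalan words w of length n avoiding (X, Y).
C : {X Y : Rel ℕ 0ℓ} → Decidable X → Decidable Y → Series
C X? Y? n = sumᴾ (map (λ w → y^ des w) (filter (avoids? X? Y?) (catalanWords n)))

{-# OPTIONS --safe #-}

-- A descent must be followed by a descent, so an avoiding word is weakly
-- increasing up to its first descent and strictly decreasing afterwards. Let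
-- W a n count the avoiding continuations of length n of a first letter a.
-- Looking at the next letter b gives
--   W a (n + 1) = ∑_{b < a} E b n + W a n + W (a + 1) n,
-- where E b n counts the strictly decreasing continuations of b, with one
-- factor y for the descent into b; thus E b (n + 1) = y ∑_{c < b} E c n. By
-- induction on n, W (a + 1) (n + 1) = W a (n + 1) + y W a n, and a = 0 gives
--   W 0 (n + 2) = 2 W 0 (n + 1) + y W 0 n.
-- So ∑ₙ W 0 n xⁿ, whose n-th coefficient is that of C at n + 1, is the inverse
-- of the denominator.
module Submission where

open import Defs
open import Data.Bool.Base using (if_then_else_; true; false)
open import Data.Integer.Base as ℤ using (ℤ; +_; 0ℤ; 1ℤ)
import Data.Integer.Properties as ℤ
open import Data.Integer.Tactic.RingSolver using (solve-∀)
open import Data.List.Base using (List; []; _∷_; _++_; map; concat; filter; applyUpTo; upTo; foldr)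
open import Data.List.Membership.Propositional using (_∈_)
open import Data.List.Membership.Propositional.Properties using (∈-upTo⁻)
open import Data.List.Properties using (upTo-∷ʳ)
open import Data.List.Relation.Unary.Any using (here; there)
open import Data.Nat.Base using (ℕ; zero; suc; _+_; _>_; _≤_; _<_)
open import Data.Nat.Properties using (_>?_; _≤?_; ≤⇒≯; <⇒≱; ≤-refl; n≤1+n; +-comm)
open import Data.Product.Base using (_,_)
open import Function.Base using (_∘_)
open import Relation.Binary.PropositionalEquality
open import Relation.Nullary.Decidable using (does; dec-true; dec-false)

open ≡-Reasoning

private variable
  A B : Set

-- Coefficients of polynomials in y.

-- Multiplication by y, acting on coefficient sequences.
shift : (ℕ → ℤ) → ℕ → ℤ
shift f zero    = 0ℤ
shift f (suc k) = f k

shift-cong : {f g : ℕ → ℤ} → (∀ k → f k ≡ g k) → ∀ k → shift f k ≡ shift g k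
shift-cong f≡g zero    = refl
shift-cong f≡g (suc k) = f≡g k

coeff-+ : ∀ p q k → coeff (p +ᴾ q) k ≡ coeff p k ℤ.+ coeff q k
coeff-+ []      q       k       = sym (ℤ.+-identityˡ _)
coeff-+ (a ∷ p) []      k       = sym (ℤ.+-identityʳ _)
coeff-+ (a ∷ p) (b ∷ q) zero    = refl
coeff-+ (a ∷ p) (b ∷ q) (suc k) = coeff-+ p q k

coeff-map-* : ∀ a q k → coeff (map (a ℤ.*_) q) k ≡ a ℤ.* coeff q k
coeff-map-* a []      k       = sym (ℤ.*-zeroʳ a)
coeff-map-* a (b ∷ q) zero    = refl
coeff-map-* a (b ∷ q) (suc k) = coeff-map-* a q k

coeff-0∷ : ∀ p k → coeff (0ℤ ∷ p) k ≡ shift (coeff p) k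
coeff-0∷ p zero    = refl
coeff-0∷ p (suc k) = refl

coeff-*-∷ : ∀ a p q k → coeff ((a ∷ p) *ᴾ q) k ≡ a ℤ.* coeff q k ℤ.+ shift (coeff (p *ᴾ q)) k
coeff-*-∷ a p q k = trans (coeff-+ (map (a ℤ.*_) q) _ k)
  (cong₂ ℤ._+_ (coeff-map-* a q k) (coeff-0∷ (p *ᴾ q) k))

coeff-const-* : ∀ a q k → coeff ((a ∷ []) *ᴾ q) k ≡ a ℤ.* coeff q k
coeff-const-* a q k = trans (coeff-*-∷ a [] q k)
  (trans (cong (λ t → a ℤ.* coeff q k ℤ.+ t) (shift-0 k)) (ℤ.+-identityʳ _))
  where
  shift-0 : ∀ k → shift (λ _ → 0ℤ) k ≡ 0ℤ
  shift-0 zero    = refl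
  shift-0 (suc k) = refl

coeff--y-* : ∀ q k → coeff ((-ᴾ y) *ᴾ q) k ≡ ℤ.- shift (coeff q) k
coeff--y-* q k = trans (coeff-*-∷ 0ℤ (ℤ.- 1ℤ ∷ []) q k) (lemma k)
  where
  lemma : ∀ k → 0ℤ ℤ.* coeff q k ℤ.+ shift (coeff ((ℤ.- 1ℤ ∷ []) *ᴾ q)) k ≡ ℤ.- shift (coeff q) k
  lemma zero    = refl
  lemma (suc k) = trans (ℤ.+-identityˡ _) (trans (coeff-const-* (ℤ.- 1ℤ) q k) (ℤ.-1*i≡-i _))

-- Products with the quadratic 1 - c x - y x².

sumᴾ-zeros : ∀ n → sumᴾ (applyUpTo (λ _ → []) n) ≡ []
sumᴾ-zeros zero    = refl
sumᴾ-zeros (suc n) = sumᴾ-zeros n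

-- The parameter lets one computation serve both sides of the fraction: `c = 1` is the numerator and
-- `c = 2` the denominator.
1-cx-yx² : ℤ → Series
1-cx-yx² c = 1ᴾ ·x^ 0 - (c ∷ []) ·x^ 1 - y ·x^ 2

module _ (c : ℤ) (f : Series) where

  quadratic-*-0 : ∀ k → coeff ((1-cx-yx² c * f) 0) k ≡ coeff (f 0) k
  quadratic-*-0 k = begin
    coeff ((1-cx-yx² c * f) 0) k              ≡⟨ coeff-+ (1ᴾ *ᴾ f 0) [] k ⟩
    coeff (1ᴾ *ᴾ f 0) k ℤ.+ 0ℤ               ≡⟨ ℤ.+-identityʳ _ ⟩
    coeff (1ᴾ *ᴾ f 0) k                       ≡⟨ coeff-const-* 1ℤ (f 0) k ⟩
    1ℤ ℤ.* coeff (f 0) k                      ≡⟨ ℤ.*-identityˡ _ ⟩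
    coeff (f 0) k                             ∎

  quadratic-*-1 : ∀ k → coeff ((1-cx-yx² c * f) 1) k ≡ coeff (f 1) k ℤ.- c ℤ.* coeff (f 0) k
  quadratic-*-1 k = begin
    coeff ((1-cx-yx² c * f) 1) k
      ≡⟨ coeff-+ (1ᴾ *ᴾ f 1) _ k ⟩
    coeff (1ᴾ *ᴾ f 1) k ℤ.+ coeff ((ℤ.- c ∷ []) *ᴾ f 0 +ᴾ []) k
      ≡⟨ cong₂ ℤ._+_ (coeff-const-* 1ℤ (f 1) k)
           (trans (coeff-+ ((ℤ.- c ∷ []) *ᴾ f 0) [] k) (cong (ℤ._+ 0ℤ) (coeff-const-* (ℤ.- c) (f 0) k))) ⟩
    1ℤ ℤ.* coeff (f 1) k ℤ.+ (ℤ.- c ℤ.* coeff (f 0) k ℤ.+ 0ℤ)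
      ≡⟨ lemma c (coeff (f 1) k) (coeff (f 0) k) ⟩
    coeff (f 1) k ℤ.- c ℤ.* coeff (f 0) k ∎
    where
    lemma : ∀ c u v → 1ℤ ℤ.* u ℤ.+ (ℤ.- c ℤ.* v ℤ.+ 0ℤ) ≡ u ℤ.- c ℤ.* v
    lemma = solve-∀

  quadratic-*-2+ : ∀ n k → coeff ((1-cx-yx² c * f) (2 + n)) k ≡
    coeff (f (2 + n)) k ℤ.- c ℤ.* coeff (f (1 + n)) k ℤ.- shift (coeff (f n)) k
  quadratic-*-2+ n k = begin
    coeff ((1-cx-yx² c * f) (2 + n)) k
      -- The quadratic has no terms beyond x², so the other `n` products in the convolution reduce
      -- to `[]`.
      ≡⟨ cong (λ t → coeff (p₂ +ᴾ (p₁ +ᴾ (p₀ +ᴾ t))) k) (sumᴾ-zeros n) ⟩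
    coeff (p₂ +ᴾ (p₁ +ᴾ (p₀ +ᴾ []))) k
      ≡⟨ trans (coeff-+ p₂ _ k) (cong (λ t → coeff p₂ k ℤ.+ t)
           (trans (coeff-+ p₁ _ k) (cong (λ t → coeff p₁ k ℤ.+ t) (coeff-+ p₀ [] k)))) ⟩
    coeff p₂ k ℤ.+ (coeff p₁ k ℤ.+ (coeff p₀ k ℤ.+ 0ℤ))
      ≡⟨ cong₂ ℤ._+_ (coeff-const-* 1ℤ (f (2 + n)) k)
           (cong₂ (λ u v → u ℤ.+ (v ℤ.+ 0ℤ)) (coeff-const-* (ℤ.- c) (f (1 + n)) k) (coeff--y-* (f n) k)) ⟩
    1ℤ ℤ.* coeff (f (2 + n)) k ℤ.+ (ℤ.- c ℤ.* coeff (f (1 + n)) k ℤ.+ (ℤ.- shift (coeff (f n)) k ℤ.+ 0ℤ))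
      ≡⟨ lemma c (coeff (f (2 + n)) k) (coeff (f (1 + n)) k) (shift (coeff (f n)) k) ⟩
    coeff (f (2 + n)) k ℤ.- c ℤ.* coeff (f (1 + n)) k ℤ.- shift (coeff (f n)) k ∎
    where
    p₂ p₁ p₀ : Poly
    p₂ = 1ᴾ *ᴾ f (2 + n)
    p₁ = (ℤ.- c ∷ []) *ᴾ f (1 + n)
    p₀ = (-ᴾ y) *ᴾ f n
    lemma : ∀ c u v w → 1ℤ ℤ.* u ℤ.+ (ℤ.- c ℤ.* v ℤ.+ (ℤ.- w ℤ.+ 0ℤ)) ≡ u ℤ.- c ℤ.* v ℤ.- w
    lemma = solve-∀

-- Finite sums and splitting by the next letter.

∑ : List A → (A → ℤ) → ℤ
∑ xs f = foldr (λ x s → f x ℤ.+ s) 0ℤ xs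

∑-++ : (f : A → ℤ) (xs ys : List A) → ∑ (xs ++ ys) f ≡ ∑ xs f ℤ.+ ∑ ys f
∑-++ f []       ys = sym (ℤ.+-identityˡ _)
∑-++ f (x ∷ xs) ys = trans (cong (λ t → f x ℤ.+ t) (∑-++ f xs ys)) (sym (ℤ.+-assoc (f x) _ _))

∑-map : (f : B → ℤ) (g : A → B) (xs : List A) → ∑ (map g xs) f ≡ ∑ xs (f ∘ g)
∑-map f g []       = refl
∑-map f g (x ∷ xs) = cong (λ t → f (g x) ℤ.+ t) (∑-map f g xs)

∑-concat : (f : A → ℤ) (xss : List (List A)) → ∑ (concat xss) f ≡ ∑ xss (λ xs → ∑ xs f)
∑-concat f []         = refl
∑-concat f (xs ∷ xss) = trans (∑-++ f xs (concat xss)) (cong (λ t → ∑ xs f ℤ.+ t) (∑-concat f xss))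

∑-cong-∈ : {f g : A → ℤ} (xs : List A) → (∀ {x} → x ∈ xs → f x ≡ g x) → ∑ xs f ≡ ∑ xs g
∑-cong-∈ []       f≡g = refl
∑-cong-∈ (x ∷ xs) f≡g = cong₂ ℤ._+_ (f≡g (here refl)) (∑-cong-∈ xs (f≡g ∘ there))

∑-cong : {f g : A → ℤ} (xs : List A) → (∀ x → f x ≡ g x) → ∑ xs f ≡ ∑ xs g
∑-cong xs f≡g = ∑-cong-∈ xs (λ {x} _ → f≡g x)

∑-zero : (xs : List A) → ∑ xs (λ _ → 0ℤ) ≡ 0ℤ
∑-zero []       = refl
∑-zero (x ∷ xs) = trans (ℤ.+-identityˡ _) (∑-zero xs)

∑-shift : (f : A → ℕ → ℤ) (xs : List A) → ∀ k →
  ∑ xs (λ x → shift (f x) k) ≡ shift (λ j → ∑ xs (λ x → f x j)) k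
∑-shift f xs zero    = ∑-zero xs
∑-shift f xs (suc k) = refl

∑-upTo-suc : (f : ℕ → ℤ) (n : ℕ) → ∑ (upTo (suc n)) f ≡ ∑ (upTo n) f ℤ.+ f n
∑-upTo-suc f n = begin
  ∑ (upTo (suc n)) f          ≡⟨ cong (λ l → ∑ l f) (upTo-∷ʳ n) ⟨
  ∑ (upTo n ++ n ∷ []) f      ≡⟨ ∑-++ f (upTo n) (n ∷ []) ⟩
  ∑ (upTo n) f ℤ.+ (f n ℤ.+ 0ℤ) ≡⟨ cong (λ t → ∑ (upTo n) f ℤ.+ t) (ℤ.+-identityʳ _) ⟩
  ∑ (upTo n) f ℤ.+ f n        ∎

-- The letter after `a` is at most `a + 1`. The top two choices `a` and `suc a` are split off
-- because they are the ones that create no descent.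
∑-wordsFrom-suc : (f : Word → ℤ) (a n : ℕ) →
  ∑ (wordsFrom (a + 1) (suc n)) f ≡
  ∑ (upTo a) (λ b → ∑ (wordsFrom (b + 1) n) (f ∘ (b ∷_)))
    ℤ.+ ∑ (wordsFrom (a + 1) n) (f ∘ (a ∷_))
    ℤ.+ ∑ (wordsFrom (suc a + 1) n) (f ∘ (suc a ∷_))
∑-wordsFrom-suc f a n = begin
  ∑ (concat (map block (upTo (suc (a + 1))))) f
    ≡⟨ ∑-concat f (map block (upTo (suc (a + 1)))) ⟩
  ∑ (map block (upTo (suc (a + 1)))) (λ ws → ∑ ws f)
    ≡⟨ ∑-map (λ ws → ∑ ws f) block (upTo (suc (a + 1))) ⟩
  ∑ (upTo (suc (a + 1))) (λ b → ∑ (block b) f)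
    ≡⟨ ∑-cong (upTo (suc (a + 1))) (λ b → ∑-map f (b ∷_) (wordsFrom (b + 1) n)) ⟩
  ∑ (upTo (suc (a + 1))) g
    ≡⟨ cong (λ m → ∑ (upTo (suc m)) g) (+-comm a 1) ⟩
  ∑ (upTo (suc (suc a))) g
    ≡⟨ trans (∑-upTo-suc g (suc a)) (cong (ℤ._+ g (suc a)) (∑-upTo-suc g a)) ⟩
  ∑ (upTo a) g ℤ.+ g a ℤ.+ g (suc a) ∎
  where
  block : ℕ → List Word
  block b = map (b ∷_) (wordsFrom (b + 1) n)
  g : ℕ → ℤ
  g b = ∑ (wordsFrom (b + 1) n) (f ∘ (b ∷_))

-- Weights of words.

-- Giving weight zero to words that contain the pattern replaces the filtered sum by a sum over all
-- words, which can be split letter by letter.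
weight : Word → Poly
weight w = if does (avoids? _>?_ _≤?_ w) then y^ des w else 0ᴾ

-- A first step that does not descend neither starts an occurrence of the pattern nor adds to `des`.
weight-ascent : ∀ {a b} → a ≤ b → ∀ w → weight (a ∷ b ∷ w) ≡ weight (b ∷ w)
weight-ascent {a} {b} a≤b []      rewrite dec-false (a >? b) (≤⇒≯ a≤b) = refl
weight-ascent {a} {b} a≤b (c ∷ w) rewrite dec-false (a >? b) (≤⇒≯ a≤b) = refl

weight-descent-ascent : ∀ {a b c} → a > b → b ≤ c → ∀ w → weight (a ∷ b ∷ c ∷ w) ≡ 0ᴾ
weight-descent-ascent {a} {b} {c} a>b b≤c w
  rewrite dec-true (a >? b) a>b | dec-true (b ≤? c) b≤c = refl

-- Since `b > c`, no occurrence starts at `a`, and the descent into `b` contributes a factor y. The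
-- equality is only coefficientwise: if the rest contains the pattern, the sides are `[]` and
-- `0ℤ ∷ []`.
weight-descent-descent : ∀ {a b c} → a > b → b > c → ∀ w →
  weight (a ∷ b ∷ c ∷ w) ≈ᴾ 0ℤ ∷ weight (b ∷ c ∷ w)
weight-descent-descent {a} {b} {c} a>b b>c w k
  rewrite dec-true (a >? b) a>b | dec-false (b ≤? c) (<⇒≱ b>c)
  with does (contains? _>?_ _≤?_ (b ∷ c ∷ w)) | k
... | true  | zero  = refl
... | true  | suc _ = refl
... | false | _     = refl

-- The first letter enters only through its comparison with `b`.
weight-descent-irrelevant : ∀ {a a′ b} → a > b → a′ > b → ∀ w →
  weight (a ∷ b ∷ w) ≡ weight (a′ ∷ b ∷ w)
weight-descent-irrelevant {a} {a′} {b} a>b a′>b []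
  rewrite dec-true (a >? b) a>b | dec-true (a′ >? b) a′>b = refl
weight-descent-irrelevant {a} {a′} {b} a>b a′>b (c ∷ w)
  rewrite dec-true (a >? b) a>b | dec-true (a′ >? b) a′>b = refl

coeff-sum-filter : ∀ ws k →
  coeff (sumᴾ (map (λ w → y^ des w) (filter (avoids? _>?_ _≤?_) ws))) k ≡ ∑ ws (λ w → coeff (weight w) k)
coeff-sum-filter []       k = refl
coeff-sum-filter (w ∷ ws) k with does (avoids? _>?_ _≤?_ w)
... | true  = trans (coeff-+ (y^ des w) _ k) (cong (λ t → coeff (y^ des w) k ℤ.+ t) (coeff-sum-filter ws k))
... | false = trans (coeff-sum-filter ws k) (sym (ℤ.+-identityˡ _))

-- Recurrences for the continuations of a letter.

W : (a n k : ℕ) → ℤ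
W a n k = ∑ (wordsFrom (a + 1) n) (λ w → coeff (weight (a ∷ w)) k)

-- The leading suc b only creates the descent into b, which forces the rest to
-- decrease; any letter larger than b would do.
E : (b n k : ℕ) → ℤ
E b n k = ∑ (wordsFrom (b + 1) n) (λ w → coeff (weight (suc b ∷ b ∷ w)) k)

∑E : (a n k : ℕ) → ℤ
∑E a n k = ∑ (upTo a) (λ b → E b n k)

W-suc : ∀ a n k → W a (suc n) k ≡ ∑E a n k ℤ.+ W a n k ℤ.+ W (suc a) n k
W-suc a n k = trans (∑-wordsFrom-suc (λ w → coeff (weight (a ∷ w)) k) a n)
  (cong₂ ℤ._+_ (cong₂ ℤ._+_
    -- Membership in `upTo a` gives `b < a`, so the leading `a` may be replaced by the `suc b` of
    -- `E`.
    (∑-cong-∈ (upTo a) λ {b} b∈ → ∑-cong (wordsFrom (b + 1) n) λ w →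
      cong (λ p → coeff p k) (weight-descent-irrelevant (∈-upTo⁻ b∈) ≤-refl w))
    (∑-cong (wordsFrom (a + 1) n) λ w → cong (λ p → coeff p k) (weight-ascent ≤-refl w)))
    (∑-cong (wordsFrom (suc a + 1) n) λ w → cong (λ p → coeff p k) (weight-ascent (n≤1+n a) w)))

-- Only a next letter `c < b` survives: the letters `b` and `suc b` complete the forbidden pattern.
E-suc : ∀ b n k → E b (suc n) k ≡ shift (∑E b n) k
E-suc b n k = begin
  E b (suc n) k
    ≡⟨ ∑-wordsFrom-suc (λ w → coeff (weight (suc b ∷ b ∷ w)) k) b n ⟩
  ∑ (upTo b) (λ c → ∑ (wordsFrom (c + 1) n) (λ w → coeff (weight (suc b ∷ b ∷ c ∷ w)) k))
    ℤ.+ ∑ (wordsFrom (b + 1) n) (λ w → coeff (weight (suc b ∷ b ∷ b ∷ w)) k)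
    ℤ.+ ∑ (wordsFrom (suc b + 1) n) (λ w → coeff (weight (suc b ∷ b ∷ suc b ∷ w)) k)
    ≡⟨ cong₂ ℤ._+_ (cong₂ ℤ._+_
         (∑-cong-∈ (upTo b) (λ c∈ → below (∈-upTo⁻ c∈)))
         (notBelow b ≤-refl))
         (notBelow (suc b) (n≤1+n b)) ⟩
  ∑ (upTo b) (λ c → shift (E c n) k) ℤ.+ 0ℤ ℤ.+ 0ℤ
    ≡⟨ trans (ℤ.+-identityʳ _) (ℤ.+-identityʳ _) ⟩
  ∑ (upTo b) (λ c → shift (E c n) k)
    ≡⟨ ∑-shift (λ c → E c n) (upTo b) k ⟩
  shift (∑E b n) k ∎
  where
  below : ∀ {c} → c < b →
    ∑ (wordsFrom (c + 1) n) (λ w → coeff (weight (suc b ∷ b ∷ c ∷ w)) k) ≡ shift (E c n) k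
  below {c} c<b = trans
    -- The first descent is paid for by `shift`; then the new leading letter `b` is normalised to
    -- `suc c`.
    (∑-cong (wordsFrom (c + 1) n) λ w →
      trans (weight-descent-descent ≤-refl c<b w k)
      (trans (coeff-0∷ (weight (b ∷ c ∷ w)) k)
      (cong (λ p → shift (coeff p) k) (weight-descent-irrelevant c<b ≤-refl w))))
    (∑-shift (λ w → coeff (weight (suc c ∷ c ∷ w))) (wordsFrom (c + 1) n) k)
  notBelow : ∀ c → b ≤ c →
    ∑ (wordsFrom (c + 1) n) (λ w → coeff (weight (suc b ∷ b ∷ c ∷ w)) k) ≡ 0ℤ
  notBelow c b≤c = trans
    (∑-cong (wordsFrom (c + 1) n) λ w → cong (λ p → coeff p k) (weight-descent-ascent ≤-refl b≤c w))
    (∑-zero (wordsFrom (c + 1) n))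

-- The induction on `n` is uniform in `a`, because the step needs the hypothesis at both `a` and
-- `suc a`.
W-suc-suc : ∀ n a k → W (suc a) (suc n) k ≡ W a (suc n) k ℤ.+ shift (W a n) k
W-suc-suc zero a k = begin
  W (suc a) 1 k
    ≡⟨ W-suc (suc a) 0 k ⟩
  ∑E (suc a) 0 k ℤ.+ one ℤ.+ one
    ≡⟨ cong (λ t → t ℤ.+ one ℤ.+ one) (∑-upTo-suc (λ b → E b 0 k) a) ⟩
  ∑E a 0 k ℤ.+ E a 0 k ℤ.+ one ℤ.+ one
    ≡⟨ cong (λ t → ∑E a 0 k ℤ.+ t ℤ.+ one ℤ.+ one) (E-zero k) ⟩
  ∑E a 0 k ℤ.+ shift (W a 0) k ℤ.+ one ℤ.+ one
    ≡⟨ lemma (∑E a 0 k) (shift (W a 0) k) one ⟩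
  ∑E a 0 k ℤ.+ one ℤ.+ one ℤ.+ shift (W a 0) k
    ≡⟨ cong (ℤ._+ shift (W a 0) k) (W-suc a 0 k) ⟨
  W a 1 k ℤ.+ shift (W a 0) k ∎
  where
  -- A one-letter word has weight 1 whatever the letter, so this also stands for `W (suc a) 0 k` and
  -- `W (2 + a) 0 k`.
  one : ℤ
  one = W a 0 k
  E-zero : ∀ k → E a 0 k ≡ shift (W a 0) k
  E-zero k rewrite dec-true (suc a >? a) ≤-refl with k
  ... | zero  = refl
  ... | suc _ = refl
  lemma : ∀ s t u → s ℤ.+ t ℤ.+ u ℤ.+ u ≡ s ℤ.+ u ℤ.+ u ℤ.+ t
  lemma = solve-∀
W-suc-suc (suc n) a k = begin
  W (suc a) (2 + n) k
    ≡⟨ W-suc (suc a) (suc n) k ⟩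
  ∑E (suc a) (suc n) k ℤ.+ W (suc a) (suc n) k ℤ.+ W (2 + a) (suc n) k
    -- The extra summand `b = a` becomes y times `∑E a n`. The unshifted and the shifted terms then
    -- regroup into two instances of `W-suc` at `a`.
    ≡⟨ cong₂ ℤ._+_ (cong₂ ℤ._+_
         (trans (∑-upTo-suc (λ b → E b (suc n) k) a) (cong (λ t → ∑E a (suc n) k ℤ.+ t) (E-suc a n k)))
         (W-suc-suc n a k))
         (W-suc-suc n (suc a) k) ⟩
  ∑E a (suc n) k ℤ.+ shift (∑E a n) k ℤ.+ (W a (suc n) k ℤ.+ shift (W a n) k)
    ℤ.+ (W (suc a) (suc n) k ℤ.+ shift (W (suc a) n) k)
    ≡⟨ lemma (∑E a (suc n) k) (shift (∑E a n) k) (W a (suc n) k) (shift (W a n) k)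
         (W (suc a) (suc n) k) (shift (W (suc a) n) k) ⟩
  ∑E a (suc n) k ℤ.+ W a (suc n) k ℤ.+ W (suc a) (suc n) k
    ℤ.+ (shift (∑E a n) k ℤ.+ shift (W a n) k ℤ.+ shift (W (suc a) n) k)
    ≡⟨ cong₂ ℤ._+_ (sym (W-suc a (suc n) k)) (sym (shift-W-suc k)) ⟩
  W a (2 + n) k ℤ.+ shift (W a (suc n)) k ∎
  where
  shift-W-suc : ∀ k → shift (W a (suc n)) k ≡ shift (∑E a n) k ℤ.+ shift (W a n) k ℤ.+ shift (W (suc a) n) k
  shift-W-suc zero    = refl
  shift-W-suc (suc k) = W-suc a n k
  lemma : ∀ s s′ u u′ v v′ → s ℤ.+ s′ ℤ.+ (u ℤ.+ u′) ℤ.+ (v ℤ.+ v′) ≡ s ℤ.+ u ℤ.+ v ℤ.+ (s′ ℤ.+ u′ ℤ.+ v′)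
  lemma = solve-∀

-- No letter lies below 0, so `∑E 0` is an empty sum, and `W-suc-suc` eliminates `W 1`.
W₀-recurrence : ∀ n k → W 0 (2 + n) k ≡ + 2 ℤ.* W 0 (1 + n) k ℤ.+ shift (W 0 n) k
W₀-recurrence n k = begin
  W 0 (2 + n) k
    ≡⟨ W-suc 0 (1 + n) k ⟩
  0ℤ ℤ.+ W 0 (1 + n) k ℤ.+ W 1 (1 + n) k
    ≡⟨ cong (λ t → 0ℤ ℤ.+ W 0 (1 + n) k ℤ.+ t) (W-suc-suc n 0 k) ⟩
  0ℤ ℤ.+ W 0 (1 + n) k ℤ.+ (W 0 (1 + n) k ℤ.+ shift (W 0 n) k)
    ≡⟨ lemma (W 0 (1 + n) k) (shift (W 0 n) k) ⟩
  + 2 ℤ.* W 0 (1 + n) k ℤ.+ shift (W 0 n) k ∎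
  where
  lemma : ∀ u v → 0ℤ ℤ.+ u ℤ.+ (u ℤ.+ v) ≡ + 2 ℤ.* u ℤ.+ v
  lemma = solve-∀

-- The generating function as a quotient.

C>≤ : Series
C>≤ = C {_>_} {_≤_} _>?_ _≤?_

-- A nonempty Catalan word starts with 0, and the rest is a continuation of that 0.
coeff-C-suc : ∀ n k → coeff (C>≤ (suc n)) k ≡ W 0 n k
coeff-C-suc n k = begin
  coeff (C>≤ (suc n)) k
    ≡⟨ coeff-sum-filter (catalanWords (suc n)) k ⟩
  ∑ (map (0 ∷_) (wordsFrom 1 n) ++ []) (λ w → coeff (weight w) k)
    ≡⟨ ∑-++ (λ w → coeff (weight w) k) (map (0 ∷_) (wordsFrom 1 n)) [] ⟩
  ∑ (map (0 ∷_) (wordsFrom 1 n)) (λ w → coeff (weight w) k) ℤ.+ 0ℤ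
    ≡⟨ ℤ.+-identityʳ _ ⟩
  ∑ (map (0 ∷_) (wordsFrom 1 n)) (λ w → coeff (weight w) k)
    ≡⟨ ∑-map (λ w → coeff (weight w) k) (0 ∷_) (wordsFrom 1 n) ⟩
  W 0 n k ∎

C-recurrence : ∀ n k →
  coeff (C>≤ (3 + n)) k ≡ + 2 ℤ.* coeff (C>≤ (2 + n)) k ℤ.+ shift (coeff (C>≤ (1 + n))) k
C-recurrence n k = begin
  coeff (C>≤ (3 + n)) k
    ≡⟨ coeff-C-suc (2 + n) k ⟩
  W 0 (2 + n) k
    ≡⟨ W₀-recurrence n k ⟩
  + 2 ℤ.* W 0 (1 + n) k ℤ.+ shift (W 0 n) k
    ≡⟨ cong₂ (λ u v → + 2 ℤ.* u ℤ.+ v) (coeff-C-suc (1 + n) k) (shift-cong (coeff-C-suc n) k) ⟨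
  + 2 ℤ.* coeff (C>≤ (2 + n)) k ℤ.+ shift (coeff (C>≤ (1 + n))) k ∎

theorem3p29 : C {_>_} {_≤_} _>?_ _≤?_
    ≈ (1ᴾ ·x^ 0 - 1ᴾ ·x^ 1 - y ·x^ 2) ÷ (1ᴾ ·x^ 0 - (+ 2 ∷ []) ·x^ 1 - y ·x^ 2)
theorem3p29 = h⁻¹ , inverse , quotient
  where
  h⁻¹ : Series
  h⁻¹ n = C>≤ (suc n)

  inverse : 1-cx-yx² (+ 2) * h⁻¹ ≈ 1ˢ
  inverse zero          k       = quadratic-*-0 (+ 2) h⁻¹ k
  -- The coefficients of `C>≤` at x and x² are the constants 1 and 2. Separating the constant term
  -- in y lets 2 - 2 · 1 = 0 be checked by computation.
  inverse (suc zero)    zero    = refl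
  inverse (suc zero)    (suc k) = quadratic-*-1 (+ 2) h⁻¹ (suc k)
  inverse (suc (suc n)) k       = begin
    coeff ((1-cx-yx² (+ 2) * h⁻¹) (2 + n)) k
      ≡⟨ quadratic-*-2+ (+ 2) h⁻¹ n k ⟩
    coeff (C>≤ (3 + n)) k ℤ.- + 2 ℤ.* u ℤ.- v
      ≡⟨ cong (λ t → t ℤ.- + 2 ℤ.* u ℤ.- v) (C-recurrence n k) ⟩
    + 2 ℤ.* u ℤ.+ v ℤ.- + 2 ℤ.* u ℤ.- v
      ≡⟨ lemma u v ⟩
    0ℤ ∎
    where
    u v : ℤ
    u = coeff (C>≤ (2 + n)) k
    v = shift (coeff (C>≤ (1 + n))) k
    lemma : ∀ u v → + 2 ℤ.* u ℤ.+ v ℤ.- + 2 ℤ.* u ℤ.- v ≡ 0ℤ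
    lemma = solve-∀

  -- The numerator is the denominator plus x, so its product with `h⁻¹` is 1 + x `h⁻¹`, which is
  -- `C>≤` with the empty word as the term 1.
  quotient : C>≤ ≈ 1-cx-yx² 1ℤ * h⁻¹
  quotient zero          k       = sym (quadratic-*-0 1ℤ h⁻¹ k)
  quotient (suc zero)    zero    = refl
  quotient (suc zero)    (suc k) = sym (quadratic-*-1 1ℤ h⁻¹ (suc k))
  quotient (suc (suc n)) k       = sym (begin
    coeff ((1-cx-yx² 1ℤ * h⁻¹) (2 + n)) k
      ≡⟨ quadratic-*-2+ 1ℤ h⁻¹ n k ⟩
    coeff (C>≤ (3 + n)) k ℤ.- 1ℤ ℤ.* u ℤ.- v
      ≡⟨ cong (λ t → t ℤ.- 1ℤ ℤ.* u ℤ.- v) (C-recurrence n k) ⟩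
    + 2 ℤ.* u ℤ.+ v ℤ.- 1ℤ ℤ.* u ℤ.- v
      ≡⟨ lemma u v ⟩
    u ∎)
    where
    u v : ℤ
    u = coeff (C>≤ (2 + n)) k
    v = shift (coeff (C>≤ (1 + n))) k
    lemma : ∀ u v → + 2 ℤ.* u ℤ.+ v ℤ.- 1ℤ ℤ.* u ℤ.- v ≡ u
    lemma = solve-∀
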